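{- There exists a function $f$ such that every graph $G$ satisfies $\chi_{\mathrm{so}}(G)\leq f(\operatorname{tw}(G))$.
   Context: All graphs are finite and simple; $\operatorname{tw}(G)$ denotes the treewidth of $G$. A proper vertex-coloring $\varphi\colon V(G)\to[t]$ of a graph $G$ is \emph{strong odd} if for every vertex $v\in V(G)$ and every color $i\in[t]$ the number $|N(v)\cap\varphi^{ -1}(i)|$ is either zero or odd; $\chi_{\mathrm{so}}(G)$ is the minimum $t$ such that $G$ admits a strong odd coloring with $t$ colors. -}

module Defs where

open import Data.Nat using (ℕ; zero; suc; _+_; _*_; _≤_; _<_)
open import Data.Fin using (Fin)
open import Data.Fin.Subset using (Subset; _∈_; ∣_∣)
open import Data.Fin.Properties using (_≟_)
open import Data.Bool using (Bool; true; false; _∧_)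
open import Data.List using (List; []; _∷_; allFin)
open import Data.List.Relation.Unary.All using (All)
open import Data.List.Relation.Unary.Unique.Propositional using (Unique)
open import Data.Product using (Σ; ∃; _×_; _,_)
open import Data.Sum using (_⊎_)
open import Data.Empty using (⊥)
open import Relation.Nullary using (¬_; does)
open import Relation.Binary.PropositionalEquality using (_≡_; _≢_)

record Graph (n : ℕ) : Set where
  field
    adj    : Fin n → Fin n → Bool
    sym    : ∀ u v → adj u v ≡ adj v u
    irrefl : ∀ v → adj v v ≡ false

open Graph public

Edge : ∀ {n} → Graph n → Fin n → Fin n → Set
Edge G u v = adj G u v ≡ true

data Walk {n} (G : Graph n) : Fin n → Fin n → Set where
  stop : ∀ u → Walk G u u
  step : ∀ {u w v} → Edge G u w → Walk G w v → Walk G u v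

support : ∀ {n} {G : Graph n} {u v} → Walk G u v → List (Fin n)
support (stop u) = u ∷ []
support (step {u = u} _ p) = u ∷ support p

len : ∀ {n} {G : Graph n} {u v} → Walk G u v → ℕ
len (stop _) = 0
len (step _ p) = suc (len p)

IsPath : ∀ {n} {G : Graph n} {u v} → Walk G u v → Set
IsPath p = Unique (support p)

Connected : ∀ {n} → Graph n → Set
Connected G = ∀ u v → Walk G u v

-- no cycle: a cycle is an edge uw together with a u-avoiding-edge path w ~> u
-- of length ≥ 2 on distinct vertices (so the cycle has length ≥ 3)
Acyclic : ∀ {n} → Graph n → Set
Acyclic G = ∀ u w → Edge G u w → (p : Walk G w u) → IsPath p → 2 ≤ len p → ⊥

IsTree : ∀ {m} → Graph m → Set
IsTree {m} T = 1 ≤ m × Connected T × Acyclic T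

record TreeDecomposition {n} (G : Graph n) (k : ℕ) : Set where
  field
    m       : ℕ
    T       : Graph m
    isTree  : IsTree T
    bag     : Fin m → Subset n
    cover-v : ∀ v → ∃ λ t → v ∈ bag t
    cover-e : ∀ u v → Edge G u v → ∃ λ t → u ∈ bag t × v ∈ bag t
    subtree : ∀ v s t → v ∈ bag s → v ∈ bag t →
              Σ (Walk T s t) λ p → All (λ r → v ∈ bag r) (support p)
    width≤  : ∀ t → ∣ bag t ∣ ≤ suc k

Treewidth≡ : ∀ {n} → Graph n → ℕ → Set
Treewidth≡ G k = TreeDecomposition G k × (∀ j → j < k → ¬ TreeDecomposition G j)

count : ∀ {A : Set} → (A → Bool) → List A → ℕ
count P [] = 0
count P (x ∷ xs) with P x
... | true  = suc (count P xs)
... | false = count P xs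

Odd : ℕ → Set
Odd x = ∃ λ k → x ≡ suc (2 * k)

record StrongOddColoring {n} (G : Graph n) (t : ℕ) : Set where
  field
    φ      : Fin n → Fin t
    proper : ∀ u v → Edge G u v → φ u ≢ φ v
    odd    : ∀ v (i : Fin t) →
             let c = count (λ u → adj G v u ∧ does (φ u ≟ i)) (allFin n)
             in c ≡ 0 ⊎ Odd c

χso≤ : ∀ {n} → Graph n → ℕ → Set
χso≤ G t = StrongOddColoring G t

module Submission where

-- A tree decomposition yields an elimination order in which the earlier neighbours
-- ("parents") of every vertex form a chain of boundedly many ancestors. Colour greedily so that
-- every vertex differs from its parents and grandparents, and record with each vertex
-- the colours of those parents that are its G-neighbours. Within one such colour class, the sets
-- of children of the vertices form a laminar family of bounded depth. Going up from the
-- singletons, one level at a time, a single extra bit makes every colour class odd or empty on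
-- the sets of the next level: if a colour occurs a positive even number of times on a set,
-- flip the bit on one subset from the previous level where that colour occurs, an odd number
-- of times.

open import Defs hiding (sym)
open import Data.Bool using (Bool; true; false; _∧_; not)
import Data.Bool.Properties as Bool
open import Data.Empty using (⊥-elim)
open import Data.Fin using (Fin; zero; suc; toℕ; combine)
open import Data.Fin.Properties using
  (_≟_; any?; combine-injectiveˡ; combine-injectiveʳ; injective⇒≤; suc-injective; toℕ<n; toℕ-injective)
open import Data.Fin.Subset using (Subset; _∈_; ∣_∣)
open import Data.Fin.Subset.Properties using (_∈?_; x∈p⇒∣p-x∣<∣p∣; x∈p∧x≢y⇒x∈p-y)
open import Data.List using
  (List; []; _∷_; _++_; allFin; concatMap; drop; filter; length; lookup; map; tabulate)
import Data.List.Extrema.Nat as Extrema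
import Data.List.Membership.DecPropositional as DecMembership
open import Data.List.Membership.Propositional using (find) renaming (_∈_ to _∈ˡ_; _∉_ to _∉ˡ_)
open import Data.List.Membership.Propositional.Properties using
  (∈-allFin; ∈-map⁺; ∈-++⁺ˡ; ∈-++⁺ʳ; ∈-++⁻; ∈-concatMap⁺; ∈-concatMap⁻; ∈-filter⁺; ∈-filter⁻; ∈-tabulate⁺)
import Data.List.Properties as List
open import Data.List.Relation.Unary.All using (All; []; _∷_)
import Data.List.Relation.Unary.All as All
import Data.List.Relation.Unary.All.Properties as All
open import Data.List.Relation.Unary.AllPairs using (AllPairs; []; _∷_)
import Data.List.Relation.Unary.AllPairs as AllPairs
import Data.List.Relation.Unary.AllPairs.Properties as AllPairs
open import Data.List.Relation.Unary.Any using (here; there; index)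
import Data.List.Relation.Unary.Any as Any
import Data.List.Relation.Unary.Any.Properties as Any
open import Data.List.Relation.Unary.Unique.Propositional using (Unique)
open import Data.List.Relation.Unary.Unique.Propositional.Properties using (allFin⁺)
open import Data.Nat using
  (ℕ; zero; suc; _+_; _*_; _≤_; _<_; z≤n; s≤s; _≤′_; ≤′-refl; ≤′-step)
import Data.Nat.Properties as ℕ
open import Data.Product using (Σ; ∃; _×_; _,_; proj₁; proj₂)
open import Data.Sum using (_⊎_; inj₁; inj₂; [_,_]′)
open import Function using (_∘_; const; mk⇔)
open import Level using (0ℓ)
open import Relation.Binary.Definitions using (DecidableEquality; tri<; tri≈; tri>)
open import Relation.Binary.PropositionalEquality
  using (_≡_; _≢_; refl; sym; trans; cong; cong₂; subst)
open import Relation.Nullary using (Dec; yes; no; does; contradiction; ¬?)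
open import Relation.Nullary.Decidable using (_×-dec_; does-⇔; dec-true; decidable-stable)
open import Relation.Unary using (Pred; Decidable)

private variable
  X : Set
  n : ℕ

_∈ˡ?_ : (x : Fin n) (xs : List (Fin n)) → Dec (x ∈ˡ xs)
_∈ˡ?_ = DecMembership._∈?_ _≟_

-- Counting and parity

Even : ℕ → Set
Even x = ∃ λ k → x ≡ 2 * k

ZeroOrOdd : ℕ → Set
ZeroOrOdd x = x ≡ 0 ⊎ Odd x

even-or-odd : ∀ x → Even x ⊎ Odd x
even-or-odd zero = inj₁ (0 , refl)
even-or-odd (suc x) with even-or-odd x
... | inj₁ (k , refl) = inj₂ (k , refl)
... | inj₂ (k , refl) = inj₁ (suc k , cong suc (sym (ℕ.+-suc k (k + 0))))

odd+even : ∀ {x y} → Odd x → Even y → Odd (x + y)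
odd+even (k , refl) (l , refl) = k + l , cong suc (sym (ℕ.*-distribˡ-+ 2 k l))

even∸odd : ∀ {x y} → Even (x + y) → Odd x → Odd y
even∸odd {y = y} (k , eq) ox with even-or-odd y
... | inj₂ oy = oy
... | inj₁ ey with odd+even ox ey
...   | l , eq′ = contradiction (trans (sym eq) eq′) (ℕ.even≢odd k l)

count-cong : ∀ {P Q : X → Bool} → (∀ x → P x ≡ Q x) → ∀ xs → count P xs ≡ count Q xs
count-cong P≗Q [] = refl
count-cong {P = P} {Q} P≗Q (x ∷ xs) with P x | Q x | P≗Q x
... | true  | .true  | refl = cong suc (count-cong P≗Q xs)
... | false | .false | refl = count-cong P≗Q xs

count-split : ∀ (P Q : X → Bool) xs →
              count P xs ≡ count (λ x → P x ∧ Q x) xs + count (λ x → P x ∧ not (Q x)) xs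
count-split P Q [] = refl
count-split P Q (x ∷ xs) with P x | Q x
... | false | _     = count-split P Q xs
... | true  | true  = cong suc (count-split P Q xs)
... | true  | false = trans (cong suc (count-split P Q xs)) (sym (ℕ.+-suc _ _))

count-witness : ∀ (P : X → Bool) xs → count P xs ≡ 0 ⊎ ∃ λ x → x ∈ˡ xs × P x ≡ true
count-witness P [] = inj₁ refl
count-witness P (x ∷ xs) with P x in eq
... | true = inj₂ (x , here refl , eq)
... | false with count-witness P xs
...   | inj₁ none = inj₁ none
...   | inj₂ (y , y∈xs , Py) = inj₂ (y , there y∈xs , Py)

count-≢0 : ∀ (P : X → Bool) {x xs} → x ∈ˡ xs → P x ≡ true → count P xs ≢ 0
count-≢0 P {xs = x ∷ _} x∈xs Px with P x in eq
count-≢0 P _            _  | true  = λ ()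
count-≢0 P (here refl)  Px | false = contradiction (trans (sym eq) Px) λ ()
count-≢0 P (there x∈xs) Px | false = count-≢0 P x∈xs Px

count-subsingleton : ∀ (P : X → Bool) → (∀ {x y} → P x ≡ true → P y ≡ true → x ≡ y) →
                     ∀ {xs} → Unique xs → ZeroOrOdd (count P xs)
count-subsingleton P uniq [] = inj₁ refl
count-subsingleton P uniq {x ∷ xs} (x≢xs ∷ xs!) with P x in eq
... | false = count-subsingleton P uniq xs!
... | true with count-witness P xs
...   | inj₁ none            = inj₂ (0 , cong suc none)
...   | inj₂ (y , y∈xs , Py) = contradiction (uniq eq Py) (All.lookup x≢xs y∈xs)

does-true : ∀ {A : Set} (a? : Dec A) → does a? ≡ true → A
does-true (yes a) _ = a

module _ {P : Pred (Fin n) 0ℓ} (P? : Decidable P) where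

  card : ℕ
  card = count (does ∘ P?) (allFin n)

  OddOrEmpty : Set
  OddOrEmpty = ZeroOrOdd card

  card-witness : card ≡ 0 ⊎ ∃ P
  card-witness with count-witness (does ∘ P?) (allFin n)
  ... | inj₁ none         = inj₁ none
  ... | inj₂ (x , _ , Px) = inj₂ (x , does-true (P? x) Px)

  card-≢0 : ∀ {x} → P x → card ≢ 0
  card-≢0 {x} Px = count-≢0 (does ∘ P?) (∈-allFin x) (dec-true (P? x) Px)

  -- An empty class is harmless, so a member may be assumed; its fibre and colour then replace
  -- arbitrary ones.
  oddOrEmpty-inhabited : (∀ {x} → P x → OddOrEmpty) → OddOrEmpty
  oddOrEmpty-inhabited oe with card-witness
  ... | inj₁ none     = inj₁ none
  ... | inj₂ (_ , Px) = oe Px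

  oddOrEmpty-subsingleton : (∀ {x y} → P x → P y → x ≡ y) → OddOrEmpty
  oddOrEmpty-subsingleton uniq = count-subsingleton (does ∘ P?)
    (λ {x} {y} Px Py → uniq (does-true (P? x) Px) (does-true (P? y) Py)) (allFin⁺ n)

module _ {P Q : Pred (Fin n) 0ℓ} (P? : Decidable P) (Q? : Decidable Q)
         (P⊆Q : ∀ {x} → P x → Q x) (Q⊆P : ∀ {x} → Q x → P x) where

  card-⇔ : card P? ≡ card Q?
  card-⇔ = count-cong (λ x → does-⇔ (mk⇔ P⊆Q Q⊆P) (P? x) (Q? x)) (allFin n)

  oddOrEmpty-⇔ : OddOrEmpty P? → OddOrEmpty Q?
  oddOrEmpty-⇔ = subst ZeroOrOdd card-⇔

-- Each refinement pairs a colour with one bit; the recursive form lets `combine` land here without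
-- a cast.
colours : ℕ → ℕ → ℕ
colours t zero    = t
colours t (suc l) = colours t l * 2

bit : Bool → Fin 2
bit false = zero
bit true  = suc zero

bit-injective : ∀ {a b} → bit a ≡ bit b → a ≡ b
bit-injective {false} {false} _ = refl
bit-injective {true}  {true}  _ = refl

-- Odd refinements of a colouring

module OddRefinement {A : Set} (_≟ᴬ_ : DecidableEquality A) where

  class? : ∀ {t} (r : Fin n → A) (f : Fin n → Fin t) ρ c →
           Decidable (λ x → r x ≡ ρ × f x ≡ c)
  class? r f ρ c x = (r x ≟ᴬ ρ) ×-dec (f x ≟ c)

  -- The map stands for the partition of the vertices into its fibres.
  OddOn : ∀ {t} → (Fin n → A) → (Fin n → Fin t) → Set
  OddOn r f = ∀ ρ c → OddOrEmpty (class? r f ρ c)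

  module _ {t} (r s : Fin n → A) (s⇒r : ∀ {x y} → s x ≡ s y → r x ≡ r y)
           (f : Fin n → Fin t) (odd-s : OddOn s f) where

    half? : ∀ ρ c (g : A → Bool) b → Decidable (λ x → (r x ≡ ρ × f x ≡ c) × g (s x) ≡ b)
    half? ρ c g b x = class? r f ρ c x ×-dec (g (s x) Bool.≟ b)

    -- An even nonempty class splits into its trace on a single s-class, which is odd
    -- by assumption, and the odd remainder.
    split-class : ∀ ρ c → Σ (A → Bool) λ g → ∀ b → OddOrEmpty (half? ρ c g b)
    split-class ρ c with even-or-odd (card (class? r f ρ c)) | card-witness (class? r f ρ c)
    ... | inj₂ odd-N | _ = const false , λ where
      false → oddOrEmpty-⇔ (class? r f ρ c) (half? ρ c (const false) false) (_, refl) proj₁ (inj₂ odd-N)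
      true  → oddOrEmpty-inhabited (half? ρ c (const false) true) λ ()
    ... | inj₁ _ | inj₁ none = const false , λ b →
      oddOrEmpty-inhabited (half? ρ c (const false) b) λ Px → contradiction none (card-≢0 (class? r f ρ c) (proj₁ Px))
    ... | inj₁ even-N | inj₂ (y , refl , refl) = g , λ where
        true  → inj₂ odd-true
        false → inj₂ odd-false
      where
      g : A → Bool
      g σ = does (σ ≟ᴬ s y)

      N≡ : card (class? r f ρ c) ≡ card (half? ρ c g true) + card (half? ρ c g false)
      N≡ = trans (count-split _ (g ∘ s) (allFin _))
                 (cong₂ _+_ (count-cong (λ x → cong (does (class? r f ρ c x) ∧_) (≟true (g (s x)))) (allFin _))
                            (count-cong (λ x → cong (does (class? r f ρ c x) ∧_) (≟false (g (s x)))) (allFin _)))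
        where
        ≟true : ∀ b → b ≡ does (b Bool.≟ true)
        ≟true true  = refl
        ≟true false = refl
        ≟false : ∀ b → not b ≡ does (b Bool.≟ false)
        ≟false true  = refl
        ≟false false = refl

      odd-true : Odd (card (half? ρ c g true))
      odd-true with oddOrEmpty-⇔ (class? s f (s y) (f y)) (half? ρ c g true)
                      (λ (sx≡sy , fx≡fy) → (s⇒r sx≡sy , fx≡fy) , dec-true (_ ≟ᴬ s y) sx≡sy)
                      (λ ((_ , fx≡fy) , gsx) → does-true (_ ≟ᴬ s y) gsx , fx≡fy)
                      (odd-s (s y) (f y))
      ... | inj₂ odd  = odd
      ... | inj₁ none = contradiction none
              (card-≢0 (half? ρ c g true) {y} ((refl , refl) , dec-true (s y ≟ᴬ s y) refl))

      odd-false : Odd (card (half? ρ c g false))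
      odd-false = even∸odd (subst Even N≡ even-N) odd-true

    mark : Fin n → Bool
    mark x = proj₁ (split-class (r x) (f x)) (s x)

    refined : Fin n → Fin (t * 2)
    refined x = combine (f x) (bit (mark x))

    refined-f : ∀ {x y} → refined x ≡ refined y → f x ≡ f y
    refined-f {x} {y} = combine-injectiveˡ (f x) _ (f y) _

    refined-mark : ∀ {x y} → refined x ≡ refined y → mark x ≡ mark y
    refined-mark {x} {y} = bit-injective ∘ combine-injectiveʳ (f x) _ (f y) _

    -- `mark` sees `x` only through `r x`, `f x` and `s x`, and `s x` determines `r x`.
    refined-cong : ∀ {x y} → s x ≡ s y → f x ≡ f y → refined x ≡ refined y
    refined-cong {x} {y} s≡ f≡ = cong₂ combine f≡
      (cong bit (cong₂ (λ h σ → h σ) (cong₂ (λ ρ c → proj₁ (split-class ρ c)) (s⇒r s≡) f≡) s≡))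

    -- The refined class of `x₀` is the half of its old class that carries the bit of `x₀`.
    refined-odd : OddOn r refined
    refined-odd ρ c = oddOrEmpty-inhabited (class? r refined ρ c) λ {
      {x₀} (refl , refl) →
        let h = proj₁ (split-class (r x₀) (f x₀)) in
        oddOrEmpty-⇔ (half? (r x₀) (f x₀) h (mark x₀)) (class? r refined (r x₀) (refined x₀))
          (λ {x} ((r≡ , f≡) , m≡) → r≡ , cong₂ combine f≡
            (cong bit (trans (cong₂ (λ ρ c → proj₁ (split-class ρ c) (s x)) r≡ f≡) m≡)))
          (λ {x} (r≡ , φ≡) → (r≡ , refined-f φ≡) ,
            trans (sym (cong₂ (λ ρ c → proj₁ (split-class ρ c) (s x)) r≡ (refined-f φ≡)))
                  (refined-mark φ≡))
          (proj₂ (split-class (r x₀) (f x₀)) (mark x₀)) }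

    -- On a fibre of `q` the new bit is constant along each old colour, so the refined classes there
    -- are old ones.
    refined-odd-finer : ∀ (q : Fin n → A) → (∀ {x y} → q x ≡ q y → s x ≡ s y) →
                        OddOn q f → OddOn q refined
    refined-odd-finer q q⇒s odd-q ρ c = oddOrEmpty-inhabited (class? q refined ρ c) λ {
      {x₀} (refl , refl) →
        oddOrEmpty-⇔ (class? q f (q x₀) (f x₀)) (class? q refined (q x₀) (refined x₀))
          (λ (q≡ , f≡) → q≡ , refined-cong (q⇒s q≡) f≡)
          (λ (q≡ , φ≡) → q≡ , refined-f φ≡)
          (odd-q (q x₀) (f x₀)) }

  module _ (r : ℕ → Fin n → A)
           (r-injective : ∀ {x y} → r 0 x ≡ r 0 y → x ≡ y)
           (r-coarsen : ∀ j {x y} → r j x ≡ r j y → r (suc j) x ≡ r (suc j) y) where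

    coarsen-≤ : ∀ {i j} → i ≤ j → ∀ {x y} → r i x ≡ r i y → r j x ≡ r j y
    coarsen-≤ {i} i≤j = go (ℕ.≤⇒≤′ i≤j)
      where
      go : ∀ {j} → i ≤′ j → ∀ {x y} → r i x ≡ r i y → r j x ≡ r j y
      go ≤′-refl       = λ eq → eq
      go (≤′-step i≤j) = r-coarsen _ ∘ go i≤j

    -- Level 0 has singleton fibres. The bit for level `suc l` is built from oddness at level `l`
    -- and preserves all levels already treated, since they are finer.
    odd-refinement : ∀ {t} (f : Fin n → Fin t) l →
      Σ (Fin n → Fin (colours t l)) λ φ →
        (∀ {x y} → φ x ≡ φ y → f x ≡ f y) × (∀ j → j ≤ l → OddOn (r j) φ)
    odd-refinement f zero = f , (λ eq → eq) , λ where
      zero _ ρ c → oddOrEmpty-subsingleton (class? (r 0) f ρ c)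
        λ (rx , _) (ry , _) → r-injective (trans rx (sym ry))
    odd-refinement f (suc l) with odd-refinement f l
    ... | φ , φ⇒f , odd-φ =
        refined coarse fine (r-coarsen l) φ odd-l
      , φ⇒f ∘ refined-f coarse fine (r-coarsen l) φ odd-l
      , odd-level
      where
      coarse = r (suc l)
      fine   = r l
      odd-l  = odd-φ l ℕ.≤-refl

      odd-level : ∀ j → j ≤ suc l → OddOn (r j) (refined coarse fine (r-coarsen l) φ odd-l)
      odd-level j j≤ with ℕ.m≤n⇒m<n∨m≡n j≤
      ... | inj₂ refl = refined-odd coarse fine (r-coarsen l) φ odd-l
      ... | inj₁ (s≤s j≤l) = refined-odd-finer coarse fine (r-coarsen l) φ odd-l
                               (r j) (coarsen-≤ j≤l) (odd-φ j j≤l)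

-- Colouring along an elimination order

-- Pigeonhole: if every colour occurred, taking positions would inject `Fin (suc b)` into the
-- positions of `l`.
fresh : ∀ {b} (l : List (Fin (suc b))) → length l ≤ b → ∃ λ c → c ∉ˡ l
fresh l l≤b with any? (λ c → ¬? (c ∈ˡ? l))
... | yes found = found
... | no  none  = contradiction l≤b (ℕ.<⇒≱ (injective⇒≤ {f = λ c → index (all c)} position-injective))
  where
  all : ∀ c → c ∈ˡ l
  all c = decidable-stable (c ∈ˡ? l) λ c∉l → none (c , c∉l)
  position-injective : ∀ {c d} → index (all c) ≡ index (all d) → c ≡ d
  position-injective {c} {d} eq = trans (Any.lookup-index (all c))
    (trans (cong (lookup l) eq) (sym (Any.lookup-index (all d))))

module _ (rank : Fin n → ℕ) (earlier : Fin n → List (Fin n))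
         (rank-< : ∀ {v w} → w ∈ˡ earlier v → rank w < rank v)
         {b} (earlier-length : ∀ v → length (earlier v) ≤ b) where

  -- Stage `suc R` recolours all vertices of rank `R` at once; they do not constrain each other,
  -- because `earlier` strictly lowers the rank.
  greedy-below : ∀ R → Σ (Fin n → Fin (suc b)) λ c →
                 ∀ {v w} → rank v < R → w ∈ˡ earlier v → c v ≢ c w
  greedy-below zero = const zero , λ ()
  greedy-below (suc R) with greedy-below R
  ... | c , c-proper = c′ , c′-proper
    where
    new : ∀ v → ∃ λ a → a ∉ˡ map c (earlier v)
    new v = fresh (map c (earlier v)) (subst (_≤ b) (sym (List.length-map c (earlier v))) (earlier-length v))

    c′ : Fin n → Fin (suc b)
    c′ v with rank v ℕ.≟ R
    ... | yes _ = proj₁ (new v)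
    ... | no  _ = c v

    c′-old : ∀ {v} → rank v < R → c′ v ≡ c v
    c′-old {v} v<R with rank v ℕ.≟ R
    ... | yes v≡R = contradiction v≡R (ℕ.<⇒≢ v<R)
    ... | no  _   = refl

    c′-proper : ∀ {v w} → rank v < suc R → w ∈ˡ earlier v → c′ v ≢ c′ w
    c′-proper {v} {w} v≤R w∈ eq with rank v ℕ.≟ R
    ... | yes refl = proj₂ (new v)
          (subst (_∈ˡ _) (sym (trans eq (c′-old (rank-< w∈)))) (∈-map⁺ c w∈))
    ... | no  v≢R  = c-proper v<R w∈ (trans eq (c′-old (ℕ.<-trans (rank-< w∈) v<R)))
      where v<R = ℕ.≤∧≢⇒< (ℕ.≤-pred v≤R) v≢R

  greedy : Σ (Fin n → Fin (suc b)) λ c → ∀ {v w} → w ∈ˡ earlier v → c v ≢ c w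
  greedy with greedy-below (suc (Extrema.max 0 (tabulate rank)))
  ... | c , c-proper = c , λ {v} → c-proper
          (s≤s (All.lookup (Extrema.xs≤max 0 (tabulate rank)) (∈-tabulate⁺ v)))

-- Lists: length bounds, codes, chains and suffixes

length-concatMap-≤ : ∀ {Y : Set} (f : X → List Y) {b} → (∀ x → length (f x) ≤ b) →
                     ∀ xs → length (concatMap f xs) ≤ length xs * b
length-concatMap-≤ f f≤b [] = z≤n
length-concatMap-≤ f {b} f≤b (x ∷ xs) = begin
  length (f x ++ concatMap f xs)         ≡⟨ List.length-++ (f x) ⟩
  length (f x) + length (concatMap f xs) ≤⟨ ℕ.+-mono-≤ (f≤b x) (length-concatMap-≤ f f≤b xs) ⟩
  b + length xs * b                      ∎
  where open ℕ.≤-Reasoning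

-- This is 1 + c + ... + c^l, the number of lists of length at most `l` over `c` letters.
listCodes : ℕ → ℕ → ℕ
listCodes c zero    = 1
listCodes c (suc l) = suc (c * listCodes c l)

-- Longer lists are truncated, whence the length bounds in `encode-injective`.
encode : ∀ {c} l → List (Fin c) → Fin (listCodes c l)
encode zero    _        = zero
encode (suc l) []       = zero
encode (suc l) (x ∷ xs) = suc (combine x (encode l xs))

encode-injective : ∀ {c} l (xs ys : List (Fin c)) → length xs ≤ l → length ys ≤ l →
                   encode l xs ≡ encode l ys → xs ≡ ys
encode-injective zero    [] [] _ _ _ = refl
encode-injective (suc l) [] [] _ _ _ = refl
encode-injective (suc l) (x ∷ xs) (y ∷ ys) (s≤s xs≤l) (s≤s ys≤l) eq =
  cong₂ _∷_ (combine-injectiveˡ x _ y _ eq′)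
            (encode-injective l xs ys xs≤l ys≤l (combine-injectiveʳ x _ y _ eq′))
  where
  eq′ = suc-injective eq

allPairs-comparable : ∀ {R : X → X → Set} {xs x y} → AllPairs R xs →
                      x ∈ˡ xs → y ∈ˡ xs → x ≡ y ⊎ R x y ⊎ R y x
allPairs-comparable (_ ∷ _)    (here refl) (here refl) = inj₁ refl
allPairs-comparable (Rx ∷ _)   (here refl) (there y∈)  = inj₂ (inj₁ (All.lookup Rx y∈))
allPairs-comparable (Ry ∷ _)   (there x∈)  (here refl) = inj₂ (inj₂ (All.lookup Ry x∈))
allPairs-comparable (_ ∷ Rs)   (there x∈)  (there y∈)  = allPairs-comparable Rs x∈ y∈

drop-index-∈ : ∀ {x : X} {xs} (x∈xs : x ∈ˡ xs) → x ∈ˡ drop (toℕ (index x∈xs)) xs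
drop-index-∈ (here eq)    = here eq
drop-index-∈ (there x∈xs) = drop-index-∈ x∈xs

drop-⊆ : ∀ j {x : X} {xs} → x ∈ˡ drop j xs → x ∈ˡ xs
drop-⊆ zero                  x∈ = x∈
drop-⊆ (suc j) {xs = _ ∷ _}  x∈ = there (drop-⊆ j x∈)

drop-suc-cong : ∀ j {xs ys : List X} → drop j xs ≡ drop j ys → drop (suc j) xs ≡ drop (suc j) ys
drop-suc-cong j {xs} {ys} eq = trans (drop-suc j xs) (trans (cong (drop 1) eq) (sym (drop-suc j ys)))
  where
  drop-suc : ∀ j (xs : List X) → drop (suc j) xs ≡ drop 1 (drop j xs)
  drop-suc zero    xs       = refl
  drop-suc (suc j) []       = refl
  drop-suc (suc j) (x ∷ xs) = drop-suc j xs

-- Elimination orders and base colours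

edge-sym : ∀ (G : Graph n) {u v} → Edge G u v → Edge G v u
edge-sym G {u} {v} e = trans (Graph.sym G v u) e

-- The parents of v, latest first, are its earlier neighbours in a chordal supergraph
-- of G, and rank is a perfect elimination ordering of that supergraph.
record Elimination (G : Graph n) (width : ℕ) : Set where
  field
    rank           : Fin n → ℕ
    parents        : Fin n → List (Fin n)
    parents-length : ∀ v → length (parents v) ≤ width
    rank-<         : ∀ {v w} → w ∈ˡ parents v → rank w < rank v
    parents-chain  : ∀ v → AllPairs (λ x y → y ∈ˡ parents x) (parents v)
    edge           : ∀ {u v} → Edge G u v → u ∈ˡ parents v ⊎ v ∈ˡ parents u

-- At most `w` parents and `w * w` grandparents are to be avoided, which leaves one colour free.
baseColours : ℕ → ℕ
baseColours w = suc (w + w * w)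

-- The product counts signatures; the `w` doublings serve the suffix levels 1 to `w`.
strongOddColours : ℕ → ℕ
strongOddColours w = colours (baseColours w * listCodes (baseColours w) w) w

module _ {G : Graph n} {w} (E : Elimination G w) where
  open Elimination E

  ancestors : Fin n → List (Fin n)
  ancestors v = parents v ++ concatMap parents (parents v)

  ancestors-length : ∀ v → length (ancestors v) ≤ w + w * w
  ancestors-length v = begin
    length (ancestors v)
      ≡⟨ List.length-++ (parents v) ⟩
    length (parents v) + length (concatMap parents (parents v))
      ≤⟨ ℕ.+-mono-≤ (parents-length v) (length-concatMap-≤ parents parents-length (parents v)) ⟩
    w + length (parents v) * w
      ≤⟨ ℕ.+-monoʳ-≤ w (ℕ.*-monoˡ-≤ w (parents-length v)) ⟩
    w + w * w ∎
    where open ℕ.≤-Reasoning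

  grandparent : ∀ {u v x} → v ∈ˡ parents u → x ∈ˡ parents v → x ∈ˡ concatMap parents (parents u)
  grandparent {u} v∈ x∈ = ∈-concatMap⁺ parents {xs = parents u} (Any.map (λ { refl → x∈ }) v∈)

  ancestors-rank : ∀ {v x} → x ∈ˡ ancestors v → rank x < rank v
  ancestors-rank {v} x∈ with ∈-++⁻ (parents v) x∈
  ... | inj₁ x∈P = rank-< x∈P
  ... | inj₂ x∈PP with find (∈-concatMap⁻ parents {xs = parents v} x∈PP)
  ...   | _ , p∈Pv , x∈Pp = ℕ.<-trans (rank-< x∈Pp) (rank-< p∈Pv)

  base : Fin n → Fin (baseColours w)
  base = proj₁ (greedy rank ancestors ancestors-rank ancestors-length)

  base-ancestor : ∀ {v x} → x ∈ˡ ancestors v → base v ≢ base x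
  base-ancestor = proj₂ (greedy rank ancestors ancestors-rank ancestors-length)

  base-parent : ∀ {v x} → x ∈ˡ parents v → base v ≢ base x
  base-parent = base-ancestor ∘ ∈-++⁺ˡ

  -- Separates children of `v` from parents of `v`: neighbours of `v` with equal colours lie on the
  -- same side of it.
  base-grandparent : ∀ {u v x} → v ∈ˡ parents u → x ∈ˡ parents v → base u ≢ base x
  base-grandparent {u} v∈ x∈ = base-ancestor (∈-++⁺ʳ (parents u) (grandparent v∈ x∈))

  -- Of two distinct parents of `v` one is a parent of the other, so the greedy colouring separates
  -- them.
  base-injective : ∀ {v x y} → x ∈ˡ parents v → y ∈ˡ parents v → base x ≡ base y → x ≡ y
  base-injective {v} x∈ y∈ eq with allPairs-comparable (parents-chain v) x∈ y∈
  ... | inj₁ x≡y       = x≡y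
  ... | inj₂ (inj₁ y∈x) = contradiction eq (base-parent y∈x)
  ... | inj₂ (inj₂ x∈y) = contradiction (sym eq) (base-parent x∈y)

  map-base-injective : ∀ {v} xs ys → All (_∈ˡ parents v) xs → All (_∈ˡ parents v) ys →
                       map base xs ≡ map base ys → xs ≡ ys
  map-base-injective []       []       _         _         _  = refl
  map-base-injective (x ∷ xs) (y ∷ ys) (x∈ ∷ xs∈) (y∈ ∷ ys∈) eq =
    cong₂ _∷_ (base-injective x∈ y∈ (List.∷-injectiveˡ eq))
              (map-base-injective xs ys xs∈ ys∈ (List.∷-injectiveʳ eq))

  -- Entries before `v` have `v` as a parent and so differ from it in colour; hence equal colour
  -- words put `v` at the same position. The entries after `v` are parents of `v`, which their
  -- colours identify.
  chain-suffix : ∀ {v xs ys} → AllPairs (λ x y → y ∈ˡ parents x) xs → AllPairs (λ x y → y ∈ˡ parents x) ys →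
                 map base xs ≡ map base ys → (v∈xs : v ∈ˡ xs) → v ∈ˡ ys →
                 drop (toℕ (index v∈xs)) ys ≡ drop (toℕ (index v∈xs)) xs
  chain-suffix (xs∈ ∷ _) (ys∈ ∷ _) eq (here refl) (here refl) =
    cong (_ ∷_) (sym (map-base-injective _ _ xs∈ ys∈ (List.∷-injectiveʳ eq)))
  chain-suffix (_ ∷ _) (ys∈ ∷ _) eq (here refl) (there v∈ys) =
    contradiction (sym (List.∷-injectiveˡ eq)) (base-parent (All.lookup ys∈ v∈ys))
  chain-suffix (xs∈ ∷ _) (_ ∷ _) eq (there v∈xs) (here refl) =
    contradiction (List.∷-injectiveˡ eq) (base-parent (All.lookup xs∈ v∈xs))
  chain-suffix (_ ∷ xs-chain) (_ ∷ ys-chain) eq (there v∈xs) (there v∈ys) =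
    chain-suffix xs-chain ys-chain (List.∷-injectiveʳ eq) v∈xs v∈ys

  -- Trails, signatures and the final colouring

  adjacent? : ∀ u → Decidable (Edge G u)
  adjacent? u v = adj G u v Bool.≟ true

  trail : Fin n → List (Fin n)
  trail u = filter (adjacent? u) (parents u)

  trail-length : ∀ u → length (trail u) ≤ w
  trail-length u = ℕ.≤-trans (List.length-filter (adjacent? u) (parents u)) (parents-length u)

  trail-chain : ∀ u → AllPairs (λ x y → y ∈ˡ parents x) (trail u)
  trail-chain u = AllPairs.filter⁺ (adjacent? u) (parents-chain u)

  -- Parents have pairwise different base colours, so the position of a parent on the trail
  -- of u is determined by its base colour and the signature of u.
  signature : Fin n → Fin (baseColours w * listCodes (baseColours w) w)
  signature u = combine (base u) (encode w (map base (trail u)))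

  signature-base : ∀ {u v} → signature u ≡ signature v → base u ≡ base v
  signature-base {u} {v} = combine-injectiveˡ (base u) _ (base v) _

  signature-trail : ∀ {u v} → signature u ≡ signature v → map base (trail u) ≡ map base (trail v)
  signature-trail {u} {v} eq = encode-injective w _ _ (short u) (short v)
    (combine-injectiveʳ (base u) _ (base v) _ eq)
    where
    short : ∀ u → length (map base (trail u)) ≤ w
    short u = subst (_≤ w) (sym (List.length-map base (trail u))) (trail-length u)

  -- Among vertices with equal signatures, equal heads of suffix j force equal tails, so each
  -- set of children of a fixed vertex is a class of some suffix j; u itself is put in front
  -- to make suffix 0 injective.
  suffix : ℕ → Fin n → List (Fin n)
  suffix j u = drop j (u ∷ trail u)

  _≟ˡ_ : DecidableEquality (List (Fin n))
  _≟ˡ_ = List.≡-dec _≟_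

  open OddRefinement _≟ˡ_

  refinement = odd-refinement suffix List.∷-injectiveˡ
                 (λ j {x} {y} → drop-suc-cong j {x ∷ trail x} {y ∷ trail y}) signature w

  colouring : Fin n → Fin (strongOddColours w)
  colouring = proj₁ refinement

  φ-signature : ∀ {u v} → colouring u ≡ colouring v → signature u ≡ signature v
  φ-signature = proj₁ (proj₂ refinement)

  φ-odd : ∀ j → j ≤ w → OddOn (suffix j) colouring
  φ-odd = proj₂ (proj₂ refinement)

  φ-base : ∀ {u v} → colouring u ≡ colouring v → base u ≡ base v
  φ-base = signature-base ∘ φ-signature

  neighbour? : ∀ v i → Decidable (λ u → Edge G v u × colouring u ≡ i)
  neighbour? v i u = adjacent? v u ×-dec (colouring u ≟ i)

  -- Any neighbour `u₀` of the given colour decides the case: a parent of `v` is alone with its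
  -- colour, while the children of its colour form one class of a trail suffix.
  neighbours-odd : ∀ v i → OddOrEmpty (neighbour? v i)
  neighbours-odd v i = oddOrEmpty-inhabited (neighbour? v i) λ { {u₀} (e , refl) → by-side u₀ e (edge e) }
    where
    by-side : ∀ u₀ → Edge G v u₀ → v ∈ˡ parents u₀ ⊎ u₀ ∈ˡ parents v → OddOrEmpty (neighbour? v (colouring u₀))
    by-side u₀ e (inj₂ u₀∈Pv) =
      -- `suffix 0` is injective, so this class is just `u₀`.
      oddOrEmpty-⇔ (class? (suffix 0) colouring (suffix 0 u₀) (colouring u₀)) (neighbour? v (colouring u₀))
        (λ (s≡ , φ≡) → subst (Edge G v) (sym (List.∷-injectiveˡ s≡)) e , φ≡)
        (λ (e′ , φ≡) → cong (suffix 0) (same e′ φ≡ (edge e′)) , φ≡)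
        (φ-odd 0 z≤n (suffix 0 u₀) (colouring u₀))
      where
      same : ∀ {u} → Edge G v u → colouring u ≡ colouring u₀ → v ∈ˡ parents u ⊎ u ∈ˡ parents v → u ≡ u₀
      same _ φ≡ (inj₁ v∈Pu) = contradiction (φ-base φ≡) (base-grandparent v∈Pu u₀∈Pv)
      same _ φ≡ (inj₂ u∈Pv) = base-injective u∈Pv u₀∈Pv (φ-base φ≡)
    by-side u₀ e (inj₁ v∈Pu₀) =
      -- `suc` skips `u₀` itself; what remains is its trail from `v` onwards.
      oddOrEmpty-⇔ (class? (suffix (suc j)) colouring (drop j (trail u₀)) (colouring u₀)) (neighbour? v (colouring u₀))
        (λ {u} (s≡ , φ≡) →
          -- The shared suffix contains `v`, so `v` is on the trail of `u`.
          edge-sym G (proj₂ (∈-filter⁻ (adjacent? u) {xs = parents u}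
            (drop-⊆ j (subst (v ∈ˡ_) (sym s≡) (drop-index-∈ v∈trail))))) , φ≡)
        (λ {u} (e′ , φ≡) →
          chain-suffix (trail-chain u₀) (trail-chain u)
            (sym (signature-trail (φ-signature φ≡))) v∈trail
            (∈-filter⁺ (adjacent? u) (child e′ φ≡ (edge e′)) (edge-sym G e′)) , φ≡)
        -- The position `j` is less than the trail length, so level `suc j` is at most `w`.
        (φ-odd (suc j) (ℕ.≤-trans (toℕ<n (index v∈trail)) (trail-length u₀)) _ _)
      where
      v∈trail : v ∈ˡ trail u₀
      v∈trail = ∈-filter⁺ (adjacent? u₀) v∈Pu₀ (edge-sym G e)
      j = toℕ (index v∈trail)
      child : ∀ {u} → Edge G v u → colouring u ≡ colouring u₀ → v ∈ˡ parents u ⊎ u ∈ˡ parents v → v ∈ˡ parents u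
      child _ _  (inj₁ v∈Pu) = v∈Pu
      child _ φ≡ (inj₂ u∈Pv) = contradiction (sym (φ-base φ≡)) (base-grandparent v∈Pu₀ u∈Pv)

  elimination⇒strongOdd : StrongOddColoring G (strongOddColours w)
  elimination⇒strongOdd = record
    { φ      = colouring
    ; proper = λ u v e φ≡ → [ (λ u∈Pv → base-parent u∈Pv (sym (φ-base φ≡)))
                            , (λ v∈Pu → base-parent v∈Pu (φ-base φ≡)) ]′ (edge e)
    ; odd    = λ v i → subst ZeroOrOdd
        (count-cong (λ u → cong (_∧ does (colouring u ≟ i)) (does-≟true (adj G v u))) (allFin n))
        (neighbours-odd v i)
    }
    where
    does-≟true : ∀ b → does (b Bool.≟ true) ≡ b
    does-≟true true  = refl
    does-≟true false = refl

-- Elimination orders from tree decompositions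

-- Induction by deleting the head from `p`; the remaining entries differ from it and survive.
unique-length : ∀ {p : Subset n} {xs} → Unique xs → All (_∈ p) xs → length xs ≤ ∣ p ∣
unique-length [] [] = z≤n
unique-length (x≢xs ∷ xs!) (x∈p ∷ xs∈p) = ℕ.≤-trans
  (s≤s (unique-length xs! (All.zipWith (λ (x≢y , y∈p) → x∈p∧x≢y⇒x∈p-y y∈p (x≢y ∘ sym)) (x≢xs , xs∈p))))
  (x∈p⇒∣p-x∣<∣p∣ x∈p)

allPairs-map-All : ∀ {P : X → Set} {R S : X → X → Set} {xs} →
                   (∀ {x y} → P x → P y → R x y → S x y) →
                   All P xs → AllPairs R xs → AllPairs S xs
allPairs-map-All f []         []         = []
allPairs-map-All f (px ∷ pxs) (Rx ∷ Rxs) =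
  All.zipWith (λ (py , Rxy) → f px py Rxy) (pxs , Rx) ∷ allPairs-map-All f pxs Rxs

-- Walks and paths

module _ {G : Graph n} where

  edge-≢ : ∀ {u v} → Edge G u v → u ≢ v
  edge-≢ {u} e refl = contradiction (trans (sym e) (irrefl G u)) λ ()

  start∈ : ∀ {u v} (p : Walk G u v) → u ∈ˡ support p
  start∈ (stop _)   = here refl
  start∈ (step _ _) = here refl

  end∈ : ∀ {u v} (p : Walk G u v) → v ∈ˡ support p
  end∈ (stop _)   = here refl
  end∈ (step _ p) = there (end∈ p)

  append : ∀ {u v w} → Walk G u v → Walk G v w → Walk G u w
  append (stop _)   q = q
  append (step e p) q = step e (append p q)

  ∈-append : ∀ {u v w x} (p : Walk G u v) (q : Walk G v w) →
             x ∈ˡ support (append p q) → x ∈ˡ support p ⊎ x ∈ˡ support q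
  ∈-append (stop _)   q x∈         = inj₂ x∈
  ∈-append (step e p) q (here eq)  = inj₁ (here eq)
  ∈-append (step e p) q (there x∈) with ∈-append p q x∈
  ... | inj₁ x∈p = inj₁ (there x∈p)
  ... | inj₂ x∈q = inj₂ x∈q

  snoc : ∀ {u v w} → Walk G u v → Edge G v w → Walk G u w
  snoc p e = append p (step e (stop _))

  support-snoc : ∀ {u v w} (p : Walk G u v) (e : Edge G v w) → support (snoc p e) ≡ support p ++ w ∷ []
  support-snoc (stop _)   e = refl
  support-snoc (step _ p) e = cong (_ ∷_) (support-snoc p e)

  len-snoc : ∀ {u v w} (p : Walk G u v) (e : Edge G v w) → len (snoc p e) ≡ suc (len p)
  len-snoc (stop _)   e = refl
  len-snoc (step _ p) e = cong suc (len-snoc p e)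

  reverse : ∀ {u v} → Walk G u v → Walk G v u
  reverse (stop u)   = stop u
  reverse (step e p) = snoc (reverse p) (edge-sym G e)

  ∈-reverse : ∀ {u v x} (p : Walk G u v) → x ∈ˡ support (reverse p) → x ∈ˡ support p
  ∈-reverse (stop _) x∈ = x∈
  ∈-reverse (step e p) x∈ with ∈-append (reverse p) (step (edge-sym G e) (stop _)) x∈
  ... | inj₁ x∈p                  = there (∈-reverse p x∈p)
  ... | inj₂ (here refl)          = there (start∈ p)
  ... | inj₂ (there (here refl))  = here refl

  path-suffix : ∀ {u v x} (p : Walk G u v) → IsPath p → x ∈ˡ support p →
                Σ (Walk G x v) λ q → IsPath q × (∀ {y} → y ∈ˡ support q → y ∈ˡ support p) × len q ≤ len p
  path-suffix p@(stop _)   p! (here refl) = p , p! , (λ y∈ → y∈) , ℕ.≤-refl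
  path-suffix p@(step _ _) p! (here refl) = p , p! , (λ y∈ → y∈) , ℕ.≤-refl
  path-suffix (step _ p) (_ ∷ p!) (there x∈p) with path-suffix p p! x∈p
  ... | q , q! , q⊆p , q≤p = q , q! , there ∘ q⊆p , ℕ.m≤n⇒m≤1+n q≤p

  -- If `u` recurs on the loop-free remainder, the part from that occurrence on is kept.
  erase-loops : ∀ {u v} (p : Walk G u v) →
                Σ (Walk G u v) λ q → IsPath q × (∀ {y} → y ∈ˡ support q → y ∈ˡ support p)
  erase-loops (stop u) = stop u , ([] ∷ []) , λ y∈ → y∈
  erase-loops {u} (step e p) with erase-loops p
  ... | q , q! , q⊆p with u ∈ˡ? support q
  ...   | no  u∉q = step e q , All.¬Any⇒All¬ _ u∉q ∷ q! , λ where
            (here eq)  → here eq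
            (there y∈) → there (q⊆p y∈)
  ...   | yes u∈q with path-suffix q q! u∈q
  ...     | s , s! , s⊆q , _ = s , s! , there ∘ q⊆p ∘ s⊆q

  snoc-isPath : ∀ {u v w} (p : Walk G u v) (e : Edge G v w) → IsPath p → w ∉ˡ support p → IsPath (snoc p e)
  snoc-isPath p e p! w∉p = subst Unique (sym (support-snoc p e))
    (AllPairs.++⁺ p! ([] ∷ []) (All.tabulate λ x∈p → (λ x≡w → w∉p (subst (_∈ˡ _) x≡w x∈p)) ∷ []))

-- Root paths and depth in a tree

module RootedTree {m} {T : Graph m} (T-tree : IsTree T) where

  -- A walk avoiding `x` would contain a path from `y` to `z` that closes up through `x` to a cycle;
  -- `y ≢ z` makes it long enough.
  cut-vertex : ∀ {x y z} → Edge T x y → Edge T x z → y ≢ z →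
               (p : Walk T y z) → x ∈ˡ support p
  cut-vertex {x} xy xz y≢z p with x ∈ˡ? support p | erase-loops p
  ... | yes x∈p | _ = x∈p
  ... | no  x∉p | q , q! , q⊆p = ⊥-elim (acyclic _ _ xy cycle cycle! long)
    where
    acyclic = proj₂ (proj₂ T-tree)
    cycle   = snoc q (edge-sym T xz)
    cycle!  = snoc-isPath q (edge-sym T xz) q! (x∉p ∘ q⊆p)
    nonempty : ∀ {u v} (q : Walk T u v) → u ≢ v → 1 ≤ len q
    nonempty (stop _)   u≢u = contradiction refl u≢u
    nonempty (step _ _) _   = s≤s z≤n
    long : 2 ≤ len cycle
    long = subst (2 ≤_) (sym (len-snoc q _)) (s≤s (nonempty q y≢z))

  -- Where the paths diverge, going along one and back along the other joins two neighbours of `x`;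
  -- by `cut-vertex` one of the paths returns to `x`.
  path-unique : ∀ {x y} (p q : Walk T x y) → IsPath p → IsPath q → support p ≡ support q
  path-unique (stop _)   (stop _)   _ _ = refl
  path-unique (stop _)   (step _ q) _ (x≢q ∷ _) = contradiction refl (All.lookup x≢q (end∈ q))
  path-unique (step _ p) (stop _)   (x≢p ∷ _) _ = contradiction refl (All.lookup x≢p (end∈ p))
  path-unique (step {w = v} e p) (step {w = w} f q) (x≢p ∷ p!) (x≢q ∷ q!) with v ≟ w
  ... | yes refl = cong (_ ∷_) (path-unique p q p! q!)
  ... | no  v≢w with ∈-append p (reverse q) (cut-vertex e f v≢w (append p (reverse q)))
  ...   | inj₁ x∈p = contradiction refl (All.lookup x≢p x∈p)
  ...   | inj₂ x∈q = contradiction refl (All.lookup x≢q (∈-reverse q x∈q))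

  support-length : ∀ {x y} (p : Walk T x y) → length (support p) ≡ suc (len p)
  support-length (stop _)   = refl
  support-length (step _ p) = cong suc (support-length p)

  root : Fin m
  root = pick (proj₁ T-tree)
    where
    pick : ∀ {m} → 1 ≤ m → Fin m
    pick (s≤s _) = zero

  rootPath : ∀ x → Walk T x root
  rootPath x = proj₁ (erase-loops (proj₁ (proj₂ T-tree) x root))

  rootPath-isPath : ∀ x → IsPath (rootPath x)
  rootPath-isPath x = proj₁ (proj₂ (erase-loops (proj₁ (proj₂ T-tree) x root)))

  -- Membership in `line x` is the ancestor order of the rooted tree, with `x` included.
  line : Fin m → List (Fin m)
  line x = support (rootPath x)

  depth : Fin m → ℕ
  depth x = length (line x)

  self∈line : ∀ x → x ∈ˡ line x
  self∈line x = start∈ (rootPath x)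

  -- By uniqueness of paths, the part of `p` from `c` on is the root path of `c`.
  path-depth : ∀ {x c} (p : Walk T x root) → IsPath p → c ∈ˡ support p → c ≢ x → depth c ≤ len p
  path-depth (stop _)   _        (here refl) c≢x = contradiction refl c≢x
  path-depth (step _ _) _        (here refl) c≢x = contradiction refl c≢x
  path-depth {c = c} (step _ p) (_ ∷ p!) (there c∈p) _ with path-suffix p p! c∈p
  ... | q , q! , _ , q≤p = begin
    length (line c)    ≡⟨ cong length (path-unique (rootPath c) q (rootPath-isPath c) q!) ⟩
    length (support q) ≡⟨ support-length q ⟩
    suc (len q)        ≤⟨ s≤s q≤p ⟩
    suc (len p)        ∎
    where open ℕ.≤-Reasoning

  line-depth : ∀ {x c} → c ∈ˡ line x → c ≢ x → depth c < depth x
  line-depth {x} {c} c∈ c≢x = subst (depth c <_) (sym (support-length (rootPath x)))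
    (s≤s (path-depth (rootPath x) (rootPath-isPath x) c∈ c≢x))

  extend : ∀ {x y} → Edge T x y → x ∉ˡ line y → line x ≡ x ∷ line y
  extend {x} {y} e x∉ = path-unique (rootPath x) (step e (rootPath y)) (rootPath-isPath x)
                          (All.¬Any⇒All¬ _ x∉ ∷ rootPath-isPath y)

  -- Ends lying on each other's lines would each be strictly shallower than the other; an end off
  -- the other's line prolongs that line.
  line-edge : ∀ {x y} → Edge T x y → line x ≡ x ∷ line y ⊎ line y ≡ y ∷ line x
  line-edge {x} {y} e with x ∈ˡ? line y | y ∈ˡ? line x
  ... | no x∉ | _     = inj₁ (extend e x∉)
  ... | _     | no y∉ = inj₂ (extend (edge-sym T e) y∉)
  ... | yes x∈y | yes y∈x = contradiction (line-depth x∈y (edge-≢ {G = T} e))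
                              (ℕ.<-asym (line-depth y∈x (edge-≢ {G = T} e ∘ sym)))

  -- A step towards the root removes only the current vertex from the line, so the subtree below `c`
  -- can be left only through `c`.
  walk-avoiding : ∀ {c s t} (p : Walk T s t) → c ∈ˡ line s → c ∉ˡ support p → c ∈ˡ line t
  walk-avoiding (stop _) c∈ _ = c∈
  walk-avoiding {c} {s} (step {w = r} e p) c∈ c∉ = walk-avoiding p (up (line-edge e)) (c∉ ∘ there)
    where
    up : line s ≡ s ∷ line r ⊎ line r ≡ r ∷ line s → c ∈ˡ line r
    up (inj₂ eq) = subst (c ∈ˡ_) (sym eq) (there c∈)
    up (inj₁ eq) with subst (c ∈ˡ_) eq c∈
    ... | here c≡s  = contradiction (here c≡s) c∉
    ... | there c∈r = c∈r

  -- Traced back from its end, the walk could lose the ancestor `c` only by moving from `c` to its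
  -- parent, which is too shallow.
  lowest-on-walk : ∀ {s c} (p : Walk T s c) → All (λ r → depth c ≤ depth r) (support p) → c ∈ˡ line s
  lowest-on-walk {c = c} (stop _) _ = self∈line c
  lowest-on-walk {s} {c} (step {w = r} e p) (c≤s ∷ c≤p) = down (line-edge e)
    where
    down : line s ≡ s ∷ line r ⊎ line r ≡ r ∷ line s → c ∈ˡ line s
    down (inj₁ eq) = subst (c ∈ˡ_) (sym eq) (there (lowest-on-walk p c≤p))
    down (inj₂ eq) with subst (c ∈ˡ_) eq (lowest-on-walk p c≤p)
    ... | there c∈s = c∈s
    ... | here refl = contradiction (subst (_≤ depth s) (cong length eq) c≤s) (ℕ.<⇒≱ ℕ.≤-refl)

-- Elimination orders from vertex levels

module _ (rank : Fin n → ℕ) (rank-injective : ∀ {u v} → rank u ≡ rank v → u ≡ v) where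

  -- By injectivity each rank contributes at most one vertex, placed before those of smaller rank.
  descending : ∀ R → Σ (List (Fin n)) λ l →
    AllPairs (λ x y → rank y < rank x) l × All (λ v → rank v < R) l × (∀ {v} → rank v < R → v ∈ˡ l)
  descending zero = [] , [] , [] , λ ()
  descending (suc R) with descending R | any? (λ v → rank v ℕ.≟ R)
  ... | l , l↓ , l< , complete | yes (v , refl) =
        v ∷ l , l< ∷ l↓ , ℕ.≤-refl ∷ All.map ℕ.m≤n⇒m≤1+n l< , λ w≤v →
          [ there ∘ complete , here ∘ rank-injective ]′ (ℕ.m≤n⇒m<n∨m≡n (ℕ.≤-pred w≤v))
  ... | l , l↓ , l< , complete | no none =
        l , l↓ , All.map ℕ.m≤n⇒m≤1+n l< , λ {w} w≤R →
          [ complete , (λ w≡R → contradiction (w , w≡R) none) ]′ (ℕ.m≤n⇒m<n∨m≡n (ℕ.≤-pred w≤R))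

module Levels {G : Graph n} {w} (level : Fin n → ℕ) (home : Fin n → Subset n)
              (home-size : ∀ v → ∣ home v ∣ ≤ w)
              (home-chain : ∀ {v x y} → x ∈ home v → y ∈ home v → level x ≤ level y → x ∈ home y)
              (home-edge : ∀ {x y} → Edge G x y → level x ≤ level y → x ∈ home y) where

  -- Lexicographic by level, then index: `toℕ v` is below `n`, so ties are broken without mixing
  -- levels.
  rank : Fin n → ℕ
  rank v = level v * n + toℕ v

  rank-mono : ∀ {u v} → level u < level v → rank u < rank v
  rank-mono {u} {v} u<v = begin-strict
    level u * n + toℕ u <⟨ ℕ.+-monoʳ-< (level u * n) (toℕ<n u) ⟩
    level u * n + n     ≡⟨ ℕ.+-comm (level u * n) n ⟩
    suc (level u) * n   ≤⟨ ℕ.*-monoˡ-≤ n u<v ⟩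
    level v * n         ≤⟨ ℕ.m≤m+n _ (toℕ v) ⟩
    rank v                    ∎
    where open ℕ.≤-Reasoning

  rank-level : ∀ {u v} → rank u ≤ rank v → level u ≤ level v
  rank-level u≤v = ℕ.≮⇒≥ λ v<u → ℕ.<⇒≱ (rank-mono v<u) u≤v

  rank-injective : ∀ {u v} → rank u ≡ rank v → u ≡ v
  rank-injective {u} {v} eq = toℕ-injective (ℕ.+-cancelˡ-≡ (level u * n) _ _
    (trans eq (cong (λ d → d * n + toℕ v)
      (ℕ.≤-antisym (rank-level (ℕ.≤-reflexive (sym eq))) (rank-level (ℕ.≤-reflexive eq))))))

  below : ∀ R → Σ (List (Fin n)) _
  below = descending rank rank-injective

  parents : Fin n → List (Fin n)
  parents v = filter (_∈? home v) (proj₁ (below (rank v)))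

  parents⁺ : ∀ {v w} → rank w < rank v → w ∈ home v → w ∈ˡ parents v
  parents⁺ {v} w<v = ∈-filter⁺ (_∈? home v) (proj₂ (proj₂ (proj₂ (below (rank v)))) w<v)

  parents-home : ∀ v → All (_∈ home v) (parents v)
  parents-home v = All.tabulate (proj₂ ∘ ∈-filter⁻ (_∈? home v) {xs = proj₁ (below (rank v))})

  parents↓ : ∀ v → AllPairs (λ x y → rank y < rank x) (parents v)
  parents↓ v = AllPairs.filter⁺ (_∈? home v) (proj₁ (proj₂ (below (rank v))))

  levels⇒elimination : Elimination G w
  levels⇒elimination = record
    { rank           = rank
    ; parents        = parents
    ; parents-length = λ v → ℕ.≤-trans
        (unique-length (AllPairs.map (λ { y<x refl → ℕ.<-irrefl refl y<x }) (parents↓ v)) (parents-home v))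
        (home-size v)
    ; rank-<         = λ {v} x∈ → All.lookup (proj₁ (proj₂ (proj₂ (below (rank v)))))
        (proj₁ (∈-filter⁻ (_∈? home v) x∈))
    -- The lower-ranked of two parents has the smaller or equal level, so `home-chain` applies.
    ; parents-chain  = λ v → allPairs-map-All
        (λ x∈ y∈ y<x → parents⁺ y<x (home-chain y∈ x∈ (rank-level (ℕ.<⇒≤ y<x))))
        (parents-home v) (parents↓ v)
    ; edge           = oriented
    }
    where
    oriented : ∀ {u v} → Edge G u v → u ∈ˡ parents v ⊎ v ∈ˡ parents u
    oriented {u} {v} e with ℕ.<-cmp (rank u) (rank v)
    ... | tri< u<v _ _ = inj₁ (parents⁺ u<v (home-edge e (rank-level (ℕ.<⇒≤ u<v))))
    ... | tri> _ _ v<u = inj₂ (parents⁺ v<u (home-edge (edge-sym G e) (rank-level (ℕ.<⇒≤ v<u))))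
    ... | tri≈ _ u≡v _ = contradiction (rank-injective u≡v) (edge-≢ {G = G} e)

-- Highest nodes of a tree decomposition

module _ {G : Graph n} {k} (D : TreeDecomposition G k) where
  open TreeDecomposition D
  open RootedTree isTree

  nodes : Fin n → List (Fin m)
  nodes v = filter (λ t → v ∈? bag t) (allFin m)

  -- The highest node of the subtree of `v`; the node from `cover-v` is the default that `argmin`
  -- takes.
  top : Fin n → Fin m
  top v = Extrema.argmin depth (proj₁ (cover-v v)) (nodes v)

  ∈-top : ∀ v → v ∈ bag (top v)
  ∈-top v = Extrema.argmin-all depth (proj₂ (cover-v v))
    (All.tabulate (proj₂ ∘ ∈-filter⁻ (λ t → v ∈? bag t) {xs = allFin m}))

  top-minimal : ∀ {v s} → v ∈ bag s → depth (top v) ≤ depth s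
  top-minimal {v} {s} v∈ = All.lookup (Extrema.f[argmin]≤f[xs] (proj₁ (cover-v v)) (nodes v))
    (∈-filter⁺ (λ t → v ∈? bag t) (∈-allFin s) v∈)

  -- The walk inside the subtree of `v` from `s` to `top v` attains its least depth at its end.
  top-on-line : ∀ {v s} → v ∈ bag s → top v ∈ˡ line s
  top-on-line {v} {s} v∈s with subtree v s (top v) v∈s (∈-top v)
  ... | p , p⊆ = lowest-on-walk p (All.map top-minimal p⊆)

  -- The node `top b` is an ancestor of `t`. If the walk from `t` to `top a` inside the subtree of
  -- `a` misses it, the walk stays below it, and the depth bound forces `top b` to equal `top a`.
  bag-top : ∀ {a b t} → a ∈ bag t → b ∈ bag t → depth (top a) ≤ depth (top b) → a ∈ bag (top b)
  bag-top {a} {b} {t} a∈ b∈ a≤b with subtree a t (top a) a∈ (∈-top a)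
  ... | p , p⊆ with top b ∈ˡ? support p
  ...   | yes on  = All.lookup p⊆ on
  ...   | no  off with top b ≟ top a
  ...     | yes b≡a = subst (λ s → a ∈ bag s) (sym b≡a) (∈-top a)
  ...     | no  b≢a = contradiction (line-depth (walk-avoiding p (top-on-line b∈) off) b≢a) (ℕ.≤⇒≯ a≤b)

  -- The width `suc k` bounds the whole bag of `top v`, `v` included. Both the chain and the edge
  -- condition are instances of `bag-top`.
  treeDecomposition⇒elimination : Elimination G (suc k)
  treeDecomposition⇒elimination = Levels.levels⇒elimination (λ v → depth (top v)) (λ v → bag (top v))
    (λ v → width≤ (top v)) bag-top
    λ {x} {y} e x≤y → let t , x∈t , y∈t = cover-e x y e in bag-top x∈t y∈t x≤y

theorem9 : ∃ λ (f : ℕ → ℕ) → ∀ (n : ℕ) (G : Graph n) (k : ℕ) → Treewidth≡ G k → χso≤ G (f k)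
theorem9 = (λ k → strongOddColours (suc k)) ,
           λ _ _ _ (D , _) → elimination⇒strongOdd (treeDecomposition⇒elimination D)
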